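{- For all integers $m\ge n\ge 2$, $\gamma^{DLD}(K_n\times K_m)=\gamma^{DLD}(K_n\square K_m)$.
   Context: $K_q$ is the complete graph on vertex set $\{1,\dots,q\}$. The Cartesian product $G_1\square G_2$ has vertex set $V_1\times V_2$, with $(u_1,u_2)$ adjacent to $(v_1,v_2)$ iff ($u_1=v_1$ and $u_2v_2\in E_2$) or ($u_2=v_2$ and $u_1v_1\in E_1$). The direct product $G_1\times G_2$ has vertex set $V_1\times V_2$, with $(u_1,u_2)$ adjacent to $(v_1,v_2)$ iff $u_1v_1\in E_1$ and $u_2v_2\in E_2$. For a code (nonempty vertex subset) $C$ and vertex $v$, $I(C;v)=N[v]\cap C$, where $N[v]$ is the closed neighbourhood. A code $C$ is solid-locating-dominating if for all distinct non-codewords $u,v$, $I(C;u)\setminus I(C;v)\ne\emptyset$. $\gamma^{DLD}(G)$ is the minimum size of a solid-locating-dominating code in the finite graph $G$. -}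

module Defs where

open import Data.Fin using (Fin)
open import Data.Fin.Properties using (all?; *↔×) renaming (_≟_ to _≟ᶠ_)
open import Data.Fin.Subset using (Subset; _∉_; _∩_; _─_; ∣_∣; Nonempty; ⊤)
open import Data.Fin.Subset.Properties using (_∈?_; nonempty?; anySubset?; ∈⊤; ∣⊤∣≡n)
open import Data.Nat using (ℕ; zero; suc; _*_; _≤_; z≤n; s≤s; _≟_)
open import Data.Product using (∃; _×_; _,_)
open import Data.Product.Function.NonDependent.Propositional using (_×-↔_)
open import Data.Sum using (_⊎_; inj₁; inj₂)
import Data.Sum as Sum
open import Data.Vec using (tabulate)
open import Function.Base using (_∘_)
open import Function.Bundles using (Inverse; _↔_)
open import Function.Construct.Composition using (_↔-∘_)
open import Function.Construct.Identity using (↔-id)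
open import Function.Properties.Inverse using (↔-sym; ↔⇒↣)
open import Relation.Binary using (Rel; Symmetric; Irreflexive; DecidableEquality)
import Relation.Binary as Binary
open import Relation.Binary.PropositionalEquality
  using (_≡_; _≢_; refl; sym; subst; ≢-sym)
open import Relation.Nullary using (Dec; yes; no; contradiction)
open import Relation.Nullary.Decidable using (does; map′; ¬?; _×-dec_; _⊎-dec_; _→-dec_; via-injection)
open import Level using (0ℓ)
open import Relation.Unary using (Pred; Decidable)

-- A finite simple graph. Vertices are enumerated so that sets of vertices can be
-- represented by the library's `Subset order`.
record Graph : Set₁ where
  infix 4 _~_ _~?_
  field
    Vertex   : Set
    order    : ℕ
    enum     : Fin order ↔ Vertex
    _~_      : Rel Vertex 0ℓ
    _~?_     : Binary.Decidable _~_
    ~-sym    : Symmetric _~_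
    ~-irrefl : Irreflexive _≡_ _~_

  vertex : Fin order → Vertex
  vertex = Inverse.to enum

  index : Vertex → Fin order
  index = Inverse.from enum

  vertex-index : ∀ v → vertex (index v) ≡ v
  vertex-index = Inverse.strictlyInverseˡ enum

  infix 4 _≟ᵛ_
  _≟ᵛ_ : DecidableEquality Vertex
  _≟ᵛ_ = via-injection (↔⇒↣ (↔-sym enum)) _≟ᶠ_

  infix 4 _∉ᵛ_
  _∉ᵛ_ : Vertex → Subset order → Set
  v ∉ᵛ S = index v ∉ S

  N[_] : Vertex → Subset order
  N[ v ] = tabulate λ i → does ((vertex i ≟ᵛ v) ⊎-dec (v ~? vertex i))

  I : Subset order → Vertex → Subset order
  I C v = N[ v ] ∩ C

  IsSolidLocatingDominating : Subset order → Set
  IsSolidLocatingDominating C =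
    Nonempty C ×
    (∀ u v → u ≢ v → u ∉ᵛ C → v ∉ᵛ C → Nonempty (I C u ─ I C v))

  HasCodeOfSize : ℕ → Set
  HasCodeOfSize k = ∃ λ C → IsSolidLocatingDominating C × ∣ C ∣ ≡ k

  all-vertices? : ∀ {P : Pred Vertex 0ℓ} → Decidable P → Dec (∀ v → P v)
  all-vertices? {P} P? =
    map′ (λ h v → subst P (vertex-index v) (h (index v))) (_∘ vertex)
         (all? (P? ∘ vertex))

  isSolidLocatingDominating? : Decidable IsSolidLocatingDominating
  isSolidLocatingDominating? C =
    nonempty? C ×-dec
    all-vertices? λ u → all-vertices? λ v →
      ¬? (u ≟ᵛ v) →-dec ¬? (index u ∈? C) →-dec ¬? (index v ∈? C) →-dec
      nonempty? (I C u ─ I C v)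

  hasCodeOfSize? : Decidable HasCodeOfSize
  hasCodeOfSize? k = anySubset? λ C → isSolidLocatingDominating? C ×-dec (∣ C ∣ ≟ k)

open Graph using (Vertex; order; index; IsSolidLocatingDominating; HasCodeOfSize; hasCodeOfSize?)

-- The least k < b satisfying P, or b if there is none.
least : ∀ {P : Pred ℕ 0ℓ} → Decidable P → (b : ℕ) → ℕ
least P? zero = zero
least P? (suc b) with P? zero
... | yes _ = zero
... | no  _ = suc (least (P? ∘ suc) b)

least-satisfies : ∀ {P : Pred ℕ 0ℓ} (P? : Decidable P) {b} → P b → P (least P? b)
least-satisfies P? {zero} p = p
least-satisfies P? {suc b} p with P? zero
... | yes p₀ = p₀
... | no  _  = least-satisfies (P? ∘ suc) p

least-≤ : ∀ {P : Pred ℕ 0ℓ} (P? : Decidable P) b {k} → P k → least P? b ≤ k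
least-≤ P? zero p = z≤n
least-≤ P? (suc b) p with P? zero
least-≤ P? (suc b) p         | yes _ = z≤n
least-≤ P? (suc b) {zero}  p | no ¬p = contradiction p ¬p
least-≤ P? (suc b) {suc k} p | no _  = s≤s (least-≤ (P? ∘ suc) b p)

-- The search bound is harmless: in a graph with at least one vertex, the set of
-- all vertices is a code (see `γᴰᴸᴰ-attained`). The graph without vertices has no
-- code, and gets the value 0.
γᴰᴸᴰ : Graph → ℕ
γᴰᴸᴰ G = least (hasCodeOfSize? G) (order G)

γᴰᴸᴰ-attained : ∀ G → Vertex G → HasCodeOfSize G (γᴰᴸᴰ G)
γᴰᴸᴰ-attained G v = least-satisfies (hasCodeOfSize? G)
  (⊤ , ((index G v , ∈⊤) , λ _ _ _ u∉⊤ _ → contradiction ∈⊤ u∉⊤) , ∣⊤∣≡n (order G))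

γᴰᴸᴰ-minimal : ∀ G {C} → IsSolidLocatingDominating G C → γᴰᴸᴰ G ≤ ∣ C ∣
γᴰᴸᴰ-minimal G sld = least-≤ (hasCodeOfSize? G) (order G) (_ , sld , refl)

K : ℕ → Graph
K q = record
  { Vertex   = Fin q
  ; order    = q
  ; enum     = ↔-id (Fin q)
  ; _~_      = _≢_
  ; _~?_     = λ u v → ¬? (u ≟ᶠ v)
  ; ~-sym    = ≢-sym
  ; ~-irrefl = λ u≡v u≢v → u≢v u≡v
  }

infixr 7 _□_ _×ᴳ_

_□_ : Graph → Graph → Graph
G □ H = record
  { Vertex   = G.Vertex × H.Vertex
  ; order    = G.order * H.order
  ; enum     = (G.enum ×-↔ H.enum) ↔-∘ *↔×
  ; _~_      = λ (u₁ , u₂) (v₁ , v₂) →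
                 (u₁ ≡ v₁ × u₂ H.~ v₂) ⊎ (u₂ ≡ v₂ × u₁ G.~ v₁)
  ; _~?_     = λ (u₁ , u₂) (v₁ , v₂) →
                 (u₁ G.≟ᵛ v₁ ×-dec u₂ H.~? v₂) ⊎-dec (u₂ H.≟ᵛ v₂ ×-dec u₁ G.~? v₁)
  ; ~-sym    = Sum.map (λ (e , a) → sym e , H.~-sym a) (λ (e , a) → sym e , G.~-sym a)
  ; ~-irrefl = λ { refl (inj₁ (_ , a)) → H.~-irrefl refl a
                 ; refl (inj₂ (_ , a)) → G.~-irrefl refl a }
  }
  where module G = Graph G; module H = Graph H

_×ᴳ_ : Graph → Graph → Graph
G ×ᴳ H = record
  { Vertex   = G.Vertex × H.Vertex
  ; order    = G.order * H.order
  ; enum     = (G.enum ×-↔ H.enum) ↔-∘ *↔×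
  ; _~_      = λ (u₁ , u₂) (v₁ , v₂) → u₁ G.~ v₁ × u₂ H.~ v₂
  ; _~?_     = λ (u₁ , u₂) (v₁ , v₂) → u₁ G.~? v₁ ×-dec u₂ H.~? v₂
  ; ~-sym    = λ (a , b) → G.~-sym a , H.~-sym b
  ; ~-irrefl = λ { refl (a , _) → G.~-irrefl refl a }
  }
  where module G = Graph G; module H = Graph H

{-# OPTIONS --safe #-}
module Submission where

open import Defs
open import Data.Bool using (true)
open import Data.Fin.Properties using () renaming (_≟_ to _≟ᶠ_)
open import Data.Fin.Subset using (Subset; _∈_; _∉_; _─_; inside)
open import Data.Fin.Subset.Properties using (x∈p∩q⁺; x∈p∩q⁻; x∈p∧x∉q⇒x∈p─q; p─q⊆p)
open import Data.Nat using (ℕ; suc; zero; _*_; _≥_)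
open import Data.Product using (_,_; proj₁; map₁; map₂)
open import Data.Sum using (_⊎_; inj₁; inj₂)
open import Data.Vec using (_∷_; here; there)
open import Data.Vec.Properties using (lookup∘tabulate; lookup⇒[]=; []=⇒lookup)
open import Function.Base using (_∘_)
open import Function.Bundles using (Inverse; Equivalence; _⇔_; mk⇔)
open import Level using (0ℓ)
open import Relation.Binary using (Rel; Symmetric; Irreflexive)
import Relation.Binary as Binary
open import Relation.Binary.PropositionalEquality
  using (_≡_; _≢_; refl; sym; trans; cong; subst)
open import Relation.Nullary using (¬_; Dec; yes; no; does; contradiction)
open import Relation.Nullary.Decidable using (dec-true; _⊎-dec_)
open import Relation.Unary using (Pred; Decidable)

-- K n ×ᴳ K m is the complement of K n □ K m. For a vertex u outside a code C,
-- complementing the graph replaces I C u by C ─ I C u; hence the condition on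
-- (u , v) in one graph is the condition on (v , u) in the other, and both graphs
-- have exactly the same solid-locating-dominating codes.

-- The search inspects only which of yes and no each decision gives, and equivalent predicates
-- always give the same one.
least-cong : ∀ {P Q : Pred ℕ 0ℓ} (P? : Decidable P) (Q? : Decidable Q) →
             (∀ k → P k ⇔ Q k) → ∀ b → least P? b ≡ least Q? b
least-cong P? Q? P⇔Q zero = refl
least-cong P? Q? P⇔Q (suc b) with P? zero | Q? zero
... | yes _ | yes _ = refl
... | no _  | no _  = cong suc (least-cong (P? ∘ suc) (Q? ∘ suc) (P⇔Q ∘ suc) b)
... | yes p | no ¬q = contradiction (Equivalence.to (P⇔Q zero) p) ¬q
... | no ¬p | yes q = contradiction (Equivalence.from (P⇔Q zero) q) ¬p

x∈p─q⇒x∉q : ∀ {n} {x} (p q : Subset n) → x ∈ p ─ q → x ∉ q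
x∈p─q⇒x∉q (_ ∷ p) (inside ∷ q) ()         here
x∈p─q⇒x∉q (_ ∷ p) (_ ∷ q)      (there x∈) (there x∈q) = x∈p─q⇒x∉q p q x∈ x∈q

does⁻ : ∀ {P : Set} (P? : Dec P) → does P? ≡ true → P
does⁻ (yes p) _ = p

module Neighbourhood (G : Graph) where
  open Graph G

  inN? : ∀ x v → Dec (vertex x ≡ v ⊎ v ~ vertex x)
  inN? x v = (vertex x ≟ᵛ v) ⊎-dec (v ~? vertex x)

  x∈N[v]⁺ : ∀ {x v} → vertex x ≡ v ⊎ v ~ vertex x → x ∈ N[ v ]
  x∈N[v]⁺ {x} {v} h =
    lookup⇒[]= x _ (trans (lookup∘tabulate _ x) (dec-true (inN? x v) h))

  x∈N[v]⁻ : ∀ {x v} → x ∈ N[ v ] → vertex x ≡ v ⊎ v ~ vertex x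
  x∈N[v]⁻ {x} {v} x∈N =
    does⁻ (inN? x v) (trans (sym (lookup∘tabulate _ x)) ([]=⇒lookup x∈N))

module _ (G : Graph) {_≁_ : Rel (Graph.Vertex G) 0ℓ} (_≁?_ : Binary.Decidable _≁_)
         (≁-sym : Symmetric _≁_) (≁-irrefl : Irreflexive _≡_ _≁_) where
  open Graph G

  -- Keeping `enum` fixed lets one `Subset order` serve as a code in both graphs, with no transport.
  withAdjacency : Graph
  withAdjacency = record
    { enum = enum ; _~_ = _≁_ ; _~?_ = _≁?_ ; ~-sym = ≁-sym ; ~-irrefl = ≁-irrefl }

  module _ (~⇒¬≁ : ∀ {u v} → u ~ v → ¬ (u ≁ v))
           (¬~⇒≁ : ∀ {u v} → u ≢ v → ¬ (u ~ v) → u ≁ v) where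

    private
      module N  = Neighbourhood G
      module N′ = Neighbourhood withAdjacency

      -- This rules out the equality case of the closed neighbourhood: at a non-codeword `v`, only
      -- adjacency can put a codeword into `I C v`.
      codeword≢ : ∀ {x v C} → x ∈ C → v ∉ᵛ C → vertex x ≢ v
      codeword≢ {x} {C = C} x∈C v∉C refl =
        v∉C (subst (_∈ C) (sym (Inverse.strictlyInverseʳ enum x)) x∈C)

    complement-code : ∀ {C} → IsSolidLocatingDominating C →
                      Graph.IsSolidLocatingDominating withAdjacency C
    complement-code {C} (nonempty , separates) = nonempty , separates′
      where
      separates′ : ∀ u v → _
      -- The pair is queried in swapped order: a codeword `x` in `I C v` but not in `I C u` is the
      -- witness for `u`, `v` under `_≁_`.
      separates′ u v u≢v u∉C v∉C with separates v u (u≢v ∘ sym) v∉C u∉C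
      ... | x , x∈
          with x∈p─q⇒x∉q (I C v) (I C u) x∈ | x∈p∩q⁻ _ _ (p─q⊆p (I C v) (I C u) x∈)
      ... | x∉Iu | x∈Nv , x∈C = x , x∈p∧x∉q⇒x∈p─q (x∈p∩q⁺ (N′.x∈N[v]⁺ (inj₂ u≁x) , x∈C)) x∉I′v
        where
        u≁x : u ≁ vertex x
        u≁x = ¬~⇒≁ (codeword≢ x∈C u∉C ∘ sym)
                λ u~x → x∉Iu (x∈p∩q⁺ (N.x∈N[v]⁺ (inj₂ u~x) , x∈C))

        x∉I′v : x ∉ Graph.I withAdjacency C v
        -- Both memberships must come from adjacency, so `v` would be related to `vertex x` by `_~_`
        -- and by `_≁_` at once.
        x∉I′v x∈I′v with N.x∈N[v]⁻ x∈Nv | N′.x∈N[v]⁻ (proj₁ (x∈p∩q⁻ _ _ x∈I′v))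
        ... | inj₁ x≡v | _        = codeword≢ x∈C v∉C x≡v
        ... | inj₂ _   | inj₁ x≡v = codeword≢ x∈C v∉C x≡v
        ... | inj₂ v~x | inj₂ v≁x = ~⇒¬≁ v~x v≁x

module _ (n m : ℕ) where
  private
    module D = Graph (K n ×ᴳ K m)
    module R = Graph (K n □ K m)

  ×⇒¬□ : ∀ {u v} → u D.~ v → ¬ (u R.~ v)
  ×⇒¬□ (u₁≢v₁ , _) (inj₁ (u₁≡v₁ , _)) = u₁≢v₁ u₁≡v₁
  ×⇒¬□ (_ , u₂≢v₂) (inj₂ (u₂≡v₂ , _)) = u₂≢v₂ u₂≡v₂

  -- Non-adjacency in the direct product forces a common coordinate, but the disjunct to return is
  -- known only after deciding which one.
  ¬×⇒□ : ∀ {u v} → u ≢ v → ¬ (u D.~ v) → u R.~ v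
  ¬×⇒□ {u₁ , u₂} {v₁ , v₂} u≢v ¬× with u₁ ≟ᶠ v₁ | u₂ ≟ᶠ v₂
  ... | yes refl | _        = inj₁ (refl , λ { refl → u≢v refl })
  ... | no u₁≢v₁ | yes refl = inj₂ (refl , u₁≢v₁)
  ... | no u₁≢v₁ | no u₂≢v₂ = contradiction (u₁≢v₁ , u₂≢v₂) ¬×

  ¬□⇒× : ∀ {u v} → u ≢ v → ¬ (u R.~ v) → u D.~ v
  ¬□⇒× u≢v ¬□ =
    (λ { refl → ¬□ (inj₁ (refl , λ { refl → u≢v refl })) }) ,
    (λ { refl → ¬□ (inj₂ (refl , λ { refl → u≢v refl })) })

  -- The two products share vertices and enumeration, so `withAdjacency` turns each one into the
  -- other definitionally.
  ×-code⇔□-code : ∀ {C} → D.IsSolidLocatingDominating C ⇔ R.IsSolidLocatingDominating C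
  ×-code⇔□-code = mk⇔
    (complement-code (K n ×ᴳ K m) R._~?_ R.~-sym R.~-irrefl ×⇒¬□ ¬×⇒□)
    (complement-code (K n □ K m) D._~?_ D.~-sym D.~-irrefl (λ u□v u×v → ×⇒¬□ u×v u□v) ¬□⇒×)

theorem17 : ∀ (m n : ℕ) → m ≥ n → n ≥ 2 → γᴰᴸᴰ (K n ×ᴳ K m) ≡ γᴰᴸᴰ (K n □ K m)
theorem17 m n _ _ =
  least-cong (Graph.hasCodeOfSize? (K n ×ᴳ K m)) (Graph.hasCodeOfSize? (K n □ K m))
    (λ _ → mk⇔ (map₂ (map₁ (to (×-code⇔□-code n m))))
               (map₂ (map₁ (from (×-code⇔□-code n m)))))
    -- The `order` of both products, hence the same search bound on each side.
    (n * m)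
  where open Equivalence using (to; from)
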